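{- Let $\lambda$ be a nonzero real (or complex) number and let $k\in\mathbb{Z}$. For every integer $n\ge 0$, $$\beta_{n,\lambda}^{(k)}=(-1)^{n}\sum_{m=0}^{n}\frac{\lambda^{m}(1)_{m+1,1/\lambda}}{(m+1)^{k}}S_{2,\lambda}(n,m).$$
   Context: All generating functions are formal power series. For nonzero $\lambda$, the degenerate exponential is $e_\lambda(t)=(1+\lambda t)^{1/\lambda}=\sum_{n\ge0}\binom{1/\lambda}{n}\lambda^n t^n$. For nonzero $\mu$, put $(1)_{0,\mu}=1$ and $(1)_{n,\mu}=(1-\mu)(1-2\mu)\cdots(1-(n-1)\mu)$ for $n\ge1$ (so $(1)_{1,\mu}=1$). The degenerate Stirling numbers of the second kind $S_{2,\lambda}(n,m)$ are defined, for each $m\ge0$, by $\frac{1}{m!}(e_{\lambda}(t)-1)^{m}=\sum_{n=m}^{\infty}S_{2,\lambda}(n,m)\frac{t^{n}}{n!}$. For $k\in\mathbb{Z}$ the degenerate polylogarithm function is $l_{k,\lambda}(x)=\sum_{n=1}^{\infty}\frac{(-\lambda)^{n-1}(1)_{n,1/\lambda}}{(n-1)!\,n^{k}}x^{n}$, and the degenerate poly-Bernoulli numbers $\beta_{n,\lambda}^{(k)}$ are defined by $$\frac{l_{k,\lambda}(1-e_{\lambda}(-t))}{1-e_{\lambda}(-t)}=\sum_{n=0}^{\infty}\beta_{n,\lambda}^{(k)}\frac{t^{n}}{n!},$$ i.e. by substituting $x=1-e_\lambda(-t)$ (which has zero constant term) into the power series $l_{k,\lambda}(x)/x$. -}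

module Defs where

open import Algebra.Apartness.Bundles using (HeytingField; HeytingCommutativeRing)
open import Algebra.Bundles using (CommutativeRing; Semiring)
open import Data.Nat.Base as ℕ using (ℕ; zero; suc; _∸_; _!)

-- With x # y meaning "x - y is invertible", the real and the complex numbers
-- form Heyting fields; x # 0# is the constructive form of "x is nonzero".

underlyingRing : ∀ {c ℓ₁ ℓ₂} → HeytingField c ℓ₁ ℓ₂ → CommutativeRing c ℓ₁
underlyingRing F =
  HeytingCommutativeRing.commutativeRing (HeytingField.heytingCommutativeRing F)

CharacteristicZero : ∀ {c ℓ₁ ℓ₂} → HeytingField c ℓ₁ ℓ₂ → Set ℓ₂
CharacteristicZero F = ∀ n → .{{ℕ.NonZero n}} → (n × 1#) # 0#
  where
  open HeytingField F using (_#_; 0#; 1#)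
  open import Algebra.Definitions.RawSemiring
    (Semiring.rawSemiring (CommutativeRing.semiring (underlyingRing F))) using (_×_)

module Degenerate {c ℓ₁ ℓ₂} (F : HeytingField c ℓ₁ ℓ₂)
                  (char0 : CharacteristicZero F) where

  open import Data.Fin.Base using (Fin; toℕ)
  open import Data.Integer.Base using (ℤ; +_; -[1+_])
  open import Data.Nat.Properties using (_!≢0)
  open import Data.Product.Base using (∃; _,_; proj₁; proj₂)

  open HeytingField F using (_#_; #⇒invertible; heytingCommutativeRing)
  open CommutativeRing (underlyingRing F)
  open import Algebra.Apartness.Properties.HeytingCommutativeRing heytingCommutativeRing
    using (x-0≈x; 1#0; x#0y#0→xy#0; invertibleˡ⇒#)
  open import Algebra.Definitions.RawSemiring (Semiring.rawSemiring semiring) public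
    using (_×_; _^_; product)
  open import Algebra.Properties.CommutativeMonoid.Sum +-commutativeMonoid public
    using (sum⁺-syntax)
  import Relation.Binary.Reasoning.Setoid setoid as ≈-Reasoning

  infix  9 _⁻¹
  infixl 7 _/_ _·_ _*ₛ_ _/ₛ_
  infixl 6 _-ₛ_
  infixr 8 _^×_ _^ᶻ_ _^ₛ_
  infix  4 _≋_

  Nonzero : Set _
  Nonzero = ∃ λ x → x # 0#

  ⟨_⟩ : Nonzero → Carrier
  ⟨ x , _ ⟩ = x

  inverse : Nonzero → Carrier
  inverse (_ , x#0) = proj₁ (#⇒invertible x#0)

  inverse-* : ∀ x → ⟨ x ⟩ * inverse x ≈ 1#
  inverse-* (x , x#0) =
    trans (*-congʳ (sym (x-0≈x x))) (proj₂ (proj₂ (#⇒invertible x#0)))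

  _⁻¹ : Nonzero → Nonzero
  x ⁻¹ = inverse x , invertibleˡ⇒# (⟨ x ⟩ , trans (*-congˡ (x-0≈x _)) (inverse-* x))

  _/_ : Carrier → Nonzero → Carrier
  x / y = x * ⟨ y ⁻¹ ⟩

  _·_ : Nonzero → Nonzero → Nonzero
  (x , x#0) · (y , y#0) = x * y , x#0y#0→xy#0 x#0 y#0

  _^×_ : Nonzero → ℕ → Nonzero
  x ^× zero  = 1# , 1#0
  x ^× suc n = x · x ^× n

  _^ᶻ_ : Nonzero → ℤ → Nonzero
  x ^ᶻ (+ n)    = x ^× n
  x ^ᶻ -[1+ n ] = (x ⁻¹) ^× suc n

  [_] : (n : ℕ) → .{{ℕ.NonZero n}} → Nonzero
  [ n ] = n × 1# , char0 n

  fact : ℕ → Nonzero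
  fact n = [ n ! ] {{n !≢0}}

  PowerSeries : Set c
  PowerSeries = ℕ → Carrier

  _≋_ : PowerSeries → PowerSeries → Set ℓ₁
  f ≋ g = ∀ n → f n ≈ g n

  1ₛ : PowerSeries
  1ₛ zero    = 1#
  1ₛ (suc _) = 0#

  _-ₛ_ : PowerSeries → PowerSeries → PowerSeries
  (f -ₛ g) n = f n - g n

  _*ₛ_ : PowerSeries → PowerSeries → PowerSeries
  (f *ₛ g) n = ∑[ i ≤ n ] (f (toℕ i) * g (n ∸ toℕ i))

  _/ₛ_ : PowerSeries → Nonzero → PowerSeries
  (f /ₛ a) n = f n / a

  _^ₛ_ : PowerSeries → ℕ → PowerSeries
  f ^ₛ zero  = 1ₛ
  f ^ₛ suc m = f *ₛ f ^ₛ m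

  -- f(a t)
  rescale : Carrier → PowerSeries → PowerSeries
  rescale a f n = a ^ n * f n

  -- f(x)/x, for f with zero constant term
  divX : (f : PowerSeries) → f 0 ≈ 0# → PowerSeries
  divX f _ n = f (suc n)

  -- f(g(t)), for g with zero constant term: g ^ₛ m then has order at least m,
  -- so only m ≤ n contribute to the coefficient of tⁿ.
  substitute : (f g : PowerSeries) → g 0 ≈ 0# → PowerSeries
  substitute f g _ n = ∑[ m ≤ n ] (f (toℕ m) * (g ^ₛ toℕ m) n)

  -- Σ aₙ tⁿ/n!
  egf : (ℕ → Carrier) → PowerSeries
  egf a n = a n / fact n

  egfCoefficients : PowerSeries → (ℕ → Carrier)
  egfCoefficients f n = ⟨ fact n ⟩ * f n

  egf-egfCoefficients : ∀ f → egf (egfCoefficients f) ≋ f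
  egf-egfCoefficients f n = begin
    ⟨ fact n ⟩ * f n * inverse (fact n)    ≈⟨ *-congʳ (*-comm _ _) ⟩
    f n * ⟨ fact n ⟩ * inverse (fact n)    ≈⟨ *-assoc _ _ _ ⟩
    f n * (⟨ fact n ⟩ * inverse (fact n))  ≈⟨ *-congˡ (inverse-* (fact n)) ⟩
    f n * 1#                               ≈⟨ *-identityʳ _ ⟩
    f n                                    ∎
    where open ≈-Reasoning

  -- x (x - 1) ⋯ (x - n + 1) / n!
  binomial : Carrier → ℕ → Carrier
  binomial x n = product {n} (λ i → x - toℕ i × 1#) / fact n

  -- (1)_{n,μ} = (1 - μ) (1 - 2μ) ⋯ (1 - (n-1) μ)
  ⟨1⟩[_,_] : ℕ → Nonzero → Carrier
  ⟨1⟩[ zero  , μ ] = 1#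
  ⟨1⟩[ suc n , μ ] = product {n} (λ i → 1# - (suc (toℕ i) × 1#) * ⟨ μ ⟩)

  -- (1 + λt)^{1/λ}, expanded by the binomial series
  e : Nonzero → PowerSeries
  e ƛ n = binomial ⟨ ƛ ⁻¹ ⟩ n * ⟨ ƛ ⟩ ^ n

  -- Vanishes for n < m, because e ƛ has constant term 1.
  S₂ : Nonzero → ℕ → ℕ → Carrier
  S₂ ƛ n m = egfCoefficients ((e ƛ -ₛ 1ₛ) ^ₛ m /ₛ fact m) n

  -- The coefficient of xⁿ for n = suc j, so that n - 1 = j.
  polylog : ℤ → Nonzero → PowerSeries
  polylog k ƛ zero    = 0#
  polylog k ƛ (suc j) =
    ((- ⟨ ƛ ⟩) ^ j * ⟨1⟩[ suc j , ƛ ⁻¹ ]) / (fact j · [ suc j ] ^ᶻ k)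

  1-e[-t] : Nonzero → PowerSeries
  1-e[-t] ƛ = 1ₛ -ₛ rescale (- 1#) (e ƛ)

  1-e[-t]-constant : ∀ ƛ → 1-e[-t] ƛ 0 ≈ 0#
  1-e[-t]-constant ƛ = begin
    1# - 1# * (binomial ⟨ ƛ ⁻¹ ⟩ 0 * 1#)  ≈⟨ +-congˡ (-‿cong (*-identityˡ _)) ⟩
    1# - binomial ⟨ ƛ ⁻¹ ⟩ 0 * 1#         ≈⟨ +-congˡ (-‿cong (*-identityʳ _)) ⟩
    1# - 1# * inverse (fact 0)            ≈⟨ +-congˡ (-‿cong (*-congʳ (+-identityʳ 1#))) ⟨
    1# - ⟨ fact 0 ⟩ * inverse (fact 0)    ≈⟨ +-congˡ (-‿cong (inverse-* (fact 0))) ⟩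
    1# - 1#                               ≈⟨ -‿inverseʳ 1# ⟩
    0#                                    ∎
    where open ≈-Reasoning

  β : ℤ → Nonzero → ℕ → Carrier
  β k ƛ =
    egfCoefficients (substitute (divX (polylog k ƛ) refl) (1-e[-t] ƛ) (1-e[-t]-constant ƛ))

{-# OPTIONS --safe #-}

-- Put h = e_λ(t) - 1.  Then 1 - e_λ(-t) = -h(-t), so the coefficient of tⁿ in
-- (1 - e_λ(-t))ᵐ is (-1)ᵐ (-1)ⁿ times that of hᵐ.  The sign (-1)ᵐ turns (-λ)ᵐ
-- into λᵐ, and the 1/m! of the polylogarithm turns hᵐ into S₂(–, m).

module Submission where

open import Algebra.Apartness.Bundles using (HeytingField)
open import Algebra.Bundles using (CommutativeRing)
open import Data.Fin.Base using (toℕ)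
open import Data.Fin.Properties using (toℕ≤pred[n])
open import Data.Integer.Base using (ℤ)
open import Data.Nat.Base as ℕ using (ℕ; zero; suc; _∸_; _≤_)
open import Data.Nat.Properties using (m+[n∸m]≡n)
open import Relation.Binary.PropositionalEquality using (cong)
open import Defs

module DegenerateProperties {c ℓ₁ ℓ₂} (F : HeytingField c ℓ₁ ℓ₂)
                            (char0 : CharacteristicZero F) where

  -- The brackets ⟨_⟩ would parse ambiguously inside ≈⟨ … ⟩ and ≈⟨ … ⟨.
  open Degenerate F char0 renaming (⟨_⟩ to value)
  open CommutativeRing (underlyingRing F)
  open import Algebra.Properties.AbelianGroup +-abelianGroup using (⁻¹-anti-homo-//)
  open import Algebra.Properties.CommutativeSemiring.Exp commutativeSemiring
    using (^-congˡ; ^-homo-*; ^-distrib-*)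
  open import Algebra.Properties.Ring ring
    using (-1*x≈-x; -‿distribʳ-*; -‿involutive; x[y-z]≈xy-xz)
  open import Algebra.Properties.Semiring.Sum semiring
    using (sum-cong-≋; *-distribˡ-sum)
  open import Algebra.Solver.CommutativeMonoid *-commutativeMonoid
    using (solve; _⊜_; _⊕_)
  open import Relation.Binary.Reasoning.Setoid setoid

  -- Inverses are unique, but the field supplies the inverse of a product independently of those of
  -- its factors, so the two must be compared. This separates m! from (m+1)^k in the denominator of
  -- the polylogarithm coefficient.
  inverse-· : ∀ x y → inverse (x · y) ≈ inverse x * inverse y
  inverse-· x y = begin
    inverse (x · y)
      ≈⟨ *-identityʳ _ ⟨
    inverse (x · y) * 1#
      ≈⟨ *-congˡ (*-identityʳ 1#) ⟨
    inverse (x · y) * (1# * 1#)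
      ≈⟨ *-congˡ (*-cong (inverse-* x) (inverse-* y)) ⟨
    inverse (x · y) * (value x * inverse x * (value y * inverse y))
      -- Regrouping lets the product meet its own inverse, so that pair cancels and the two separate
      -- inverses remain.
      ≈⟨ solve 5 (λ i x x′ y y′ → i ⊕ ((x ⊕ x′) ⊕ (y ⊕ y′)) ⊜ ((x ⊕ y) ⊕ i) ⊕ (x′ ⊕ y′))
           refl (inverse (x · y)) (value x) (inverse x) (value y) (inverse y) ⟩
    value (x · y) * inverse (x · y) * (inverse x * inverse y)
      ≈⟨ *-congʳ (inverse-* (x · y)) ⟩
    1# * (inverse x * inverse y)
      ≈⟨ *-identityˡ _ ⟩
    inverse x * inverse y
      ∎

  -x*-1≈x : ∀ x → - x * - 1# ≈ x
  -x*-1≈x x = begin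
    - x * - 1#      ≈⟨ -‿distribʳ-* (- x) 1# ⟨
    - (- x * 1#)    ≈⟨ -‿cong (*-identityʳ (- x)) ⟩
    - - x           ≈⟨ -‿involutive x ⟩
    x               ∎

  -- Used to absorb the sign of an m-th power into the factor (-λ)^m of the polylogarithm.
  [-x]^n*[-1]^n≈x^n : ∀ x n → (- x) ^ n * (- 1#) ^ n ≈ x ^ n
  [-x]^n*[-1]^n≈x^n x n = begin
    (- x) ^ n * (- 1#) ^ n  ≈⟨ ^-distrib-* (- x) (- 1#) n ⟨
    (- x * - 1#) ^ n        ≈⟨ ^-congˡ n (-x*-1≈x x) ⟩
    x ^ n                   ∎

  ^-split : ∀ x {m n} → m ≤ n → x ^ m * x ^ (n ∸ m) ≈ x ^ n
  ^-split x {m} {n} m≤n = begin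
    x ^ m * x ^ (n ∸ m)   ≈⟨ ^-homo-* x m (n ∸ m) ⟨
    x ^ (m ℕ.+ (n ∸ m))   ≡⟨ cong (x ^_) (m+[n∸m]≡n m≤n) ⟩
    x ^ n                 ∎

  rescale-1ₛ : ∀ a → rescale a 1ₛ ≋ 1ₛ
  rescale-1ₛ a zero    = *-identityˡ 1#
  rescale-1ₛ a (suc n) = zeroʳ (a ^ suc n)

  -- In each term of the Cauchy product, a^i and a^(n-i) combine to a^n, which does not depend on i
  -- and so leaves the sum; each further power contributes one more b.
  scale-rescale-^ₛ : ∀ {f} b a h → (∀ n → f n ≈ b * rescale a h n) →
                     ∀ m n → (f ^ₛ m) n ≈ b ^ m * rescale a (h ^ₛ m) n
  scale-rescale-^ₛ b a h f≈ zero n =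
    sym (trans (*-identityˡ _) (rescale-1ₛ a n))
  scale-rescale-^ₛ {f} b a h f≈ (suc m) n = begin
    ∑[ i ≤ n ] (f (toℕ i) * (f ^ₛ m) (n ∸ toℕ i))
      -- The bound on the index matters: subtraction is truncated, so i + (n ∸ i) = n needs i ≤ n.
      ≈⟨ sum-cong-≋ {suc n} (λ i → term (toℕ≤pred[n] i)) ⟩
    ∑[ i ≤ n ] (b ^ suc m * a ^ n * (h (toℕ i) * (h ^ₛ m) (n ∸ toℕ i)))
      ≈⟨ *-distribˡ-sum {suc n} (b ^ suc m * a ^ n)
           (λ i → h (toℕ i) * (h ^ₛ m) (n ∸ toℕ i)) ⟨
    b ^ suc m * a ^ n * (h ^ₛ suc m) n
      ≈⟨ *-assoc _ _ _ ⟩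
    b ^ suc m * rescale a (h ^ₛ suc m) n
      ∎
    where
    term : ∀ {i} → i ≤ n → f i * (f ^ₛ m) (n ∸ i) ≈
                           b ^ suc m * a ^ n * (h i * (h ^ₛ m) (n ∸ i))
    term {i} i≤n = begin
      f i * (f ^ₛ m) (n ∸ i)
        ≈⟨ *-cong (f≈ i) (scale-rescale-^ₛ b a h f≈ m (n ∸ i)) ⟩
      b * (a ^ i * h i) * (b ^ m * (a ^ (n ∸ i) * (h ^ₛ m) (n ∸ i)))
        ≈⟨ solve 6 (λ b aⁱ x bᵐ aʲ y →
                      (b ⊕ (aⁱ ⊕ x)) ⊕ (bᵐ ⊕ (aʲ ⊕ y)) ⊜
                      ((b ⊕ bᵐ) ⊕ (aⁱ ⊕ aʲ)) ⊕ (x ⊕ y))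
             refl b (a ^ i) (h i) (b ^ m) (a ^ (n ∸ i)) ((h ^ₛ m) (n ∸ i)) ⟩
      b ^ suc m * (a ^ i * a ^ (n ∸ i)) * (h i * (h ^ₛ m) (n ∸ i))
        ≈⟨ *-congʳ (*-congˡ (^-split a i≤n)) ⟩
      b ^ suc m * a ^ n * (h i * (h ^ₛ m) (n ∸ i))
        ∎

  -- The constant series 1 is fixed by t ↦ -t. The outer sign is kept as a factor -1 to fit
  -- `scale-rescale-^ₛ` with a = b = -1.
  1-e[-t]≈-[e-1][-t] : ∀ ƛ n →
    1-e[-t] ƛ n ≈ - 1# * rescale (- 1#) (e ƛ -ₛ 1ₛ) n
  1-e[-t]≈-[e-1][-t] ƛ n = sym (begin
    - 1# * (s * (e ƛ n - 1ₛ n))  ≈⟨ -1*x≈-x _ ⟩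
    - (s * (e ƛ n - 1ₛ n))       ≈⟨ -‿cong (x[y-z]≈xy-xz s (e ƛ n) (1ₛ n)) ⟩
    - (s * e ƛ n - s * 1ₛ n)     ≈⟨ ⁻¹-anti-homo-// (s * e ƛ n) (s * 1ₛ n) ⟩
    s * 1ₛ n - s * e ƛ n         ≈⟨ +-congʳ (rescale-1ₛ (- 1#) n) ⟩
    1ₛ n - s * e ƛ n             ∎)
    where
    s : Carrier
    s = (- 1#) ^ n

  module _ (ƛ : Nonzero) (k : ℤ) (n : ℕ) where

    summand : ℕ → Carrier
    summand m = (value ƛ ^ m * ⟨1⟩[ suc m , ƛ ⁻¹ ]) / ([ suc m ] ^ᶻ k) * S₂ ƛ n m

    β-term : ∀ m →
      value (fact n) * (polylog k ƛ (suc m) * (1-e[-t] ƛ ^ₛ m) n) ≈ (- 1#) ^ n * summand m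
    β-term m = begin
      value (fact n) * (((- value ƛ) ^ m * w) / (fact m · p) * (1-e[-t] ƛ ^ₛ m) n)
        ≈⟨ *-congˡ (*-cong (*-congˡ (inverse-· (fact m) p))
             (scale-rescale-^ₛ (- 1#) (- 1#) (e ƛ -ₛ 1ₛ) (1-e[-t]≈-[e-1][-t] ƛ) m n)) ⟩
      value (fact n) * ((- value ƛ) ^ m * w * (inverse (fact m) * inverse p)
                     * ((- 1#) ^ m * ((- 1#) ^ n * x)))
        -- The factors n!, x and 1/m! are gathered in exactly the order in which `S₂ ƛ n m` unfolds,
        -- and (-λ)^m is placed next to (-1)^m.
        ≈⟨ solve 8 (λ n! l w m!′ p′ s t x →
                      n! ⊕ (((l ⊕ w) ⊕ (m!′ ⊕ p′)) ⊕ (s ⊕ (t ⊕ x))) ⊜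
                      t ⊕ ((((l ⊕ s) ⊕ w) ⊕ p′) ⊕ (n! ⊕ (x ⊕ m!′))))
             refl (value (fact n)) ((- value ƛ) ^ m) w (inverse (fact m)) (inverse p)
                  ((- 1#) ^ m) ((- 1#) ^ n) x ⟩
      (- 1#) ^ n * (((- value ƛ) ^ m * (- 1#) ^ m * w) / p * S₂ ƛ n m)
        ≈⟨ *-congˡ (*-congʳ (*-congʳ (*-congʳ ([-x]^n*[-1]^n≈x^n (value ƛ) m)))) ⟩
      (- 1#) ^ n * summand m
        ∎
      where
      p : Nonzero
      p = [ suc m ] ^ᶻ k
      w x : Carrier
      w = ⟨1⟩[ suc m , ƛ ⁻¹ ]
      x = ((e ƛ -ₛ 1ₛ) ^ₛ m) n

    -- Substitution already stops at m = n, so both sides are sums over the same range and agree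
    -- term by term.
    β-formula : β k ƛ n ≈ (- 1#) ^ n * (∑[ m ≤ n ] summand (toℕ m))
    β-formula = begin
      β k ƛ n
        -- `β k ƛ n` unfolds to n! times a sum; the shift to `suc` comes from dividing the
        -- polylogarithm by x.
        ≈⟨ *-distribˡ-sum {suc n} (value (fact n))
             (λ m → polylog k ƛ (suc (toℕ m)) * (1-e[-t] ƛ ^ₛ toℕ m) n) ⟩
      ∑[ m ≤ n ] (value (fact n) * (polylog k ƛ (suc (toℕ m)) * (1-e[-t] ƛ ^ₛ toℕ m) n))
        ≈⟨ sum-cong-≋ {suc n} (λ m → β-term (toℕ m)) ⟩
      ∑[ m ≤ n ] ((- 1#) ^ n * summand (toℕ m))
        ≈⟨ *-distribˡ-sum {suc n} ((- 1#) ^ n) (λ m → summand (toℕ m)) ⟨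
      (- 1#) ^ n * (∑[ m ≤ n ] summand (toℕ m))
        ∎

theorem4 : ∀ {c ℓ₁ ℓ₂} (F : HeytingField c ℓ₁ ℓ₂) (char0 : CharacteristicZero F) →
  let open HeytingField F
      open Degenerate F char0
  in (ƛ : Nonzero) (k : ℤ) (n : ℕ) →
     β k ƛ n ≈ (- 1#) ^ n * (∑[ m ≤ n ] ((⟨ ƛ ⟩ ^ toℕ m * ⟨1⟩[ suc (toℕ m) , ƛ ⁻¹ ]) / ([ suc (toℕ m) ] ^ᶻ k) * S₂ ƛ n (toℕ m)))
theorem4 F char0 = DegenerateProperties.β-formula F char0
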